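{- For every fixed integer $k \ge 2$ there is a constant $c_2(k) > 0$ such that the almost balanced ordered biclique covering number $f(n,k)$ of order $k$ of the complete graph $K_n$ satisfies $$f(n,k) \;\le\; (1+o(1)) \cdot c_2(k) \cdot n^{\frac{1}{\lfloor k/2\rfloor + 1} + o(1)} ,$$ where each $o(1)$ denotes a quantity tending to $0$ as $n \to \infty$ with $k$ fixed.
   Context: A biclique $B=(U,W)$ in the complete graph $K_n$ is a complete bipartite subgraph given by an ordered pair of disjoint vertex sets: a first class $U$ and a second class $W$. It contains (covers) the edge $\{u,v\}$ if one of $u,v$ lies in $U$ and the other lies in $W$. For a positive integer $k$, an almost balanced ordered biclique covering of order $k$ of $K_n$ is a finite collection of bicliques $(U_1,W_1),\dots,(U_d,W_d)$ such that: (i) every edge of $K_n$ is contained in at least one and at most $k$ of the bicliques; (ii) for every edge $\{u,v\}$, the number of indices $i$ with $u\in U_i$, $v\in W_i$ and the number of indices $i$ with $v\in U_i$, $u\in W_i$ differ by at most one. The number $d$ is the size of the collection, and $f(n,k)$ is the minimum size of an almost balanced ordered biclique covering of order $k$ of $K_n$. -}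

module Defs where

open import Algebra.Definitions.RawSemiring using () renaming (_^_ to pow)
open import Data.Bool using (if_then_else_; true; false)
open import Data.Empty using (⊥-elim-irr)
open import Data.Fin using (Fin; zero; suc; _≟_)
open import Data.Fin.Properties using (all?)
open import Data.Fin.Subset using (Subset; _∈_; _∩_; Empty; inside; outside; ⁅_⁆; ⊤)
open import Data.Fin.Subset.Properties
  using (_∈?_; nonempty?; anySubset?; x∈p∩q⁻; x∈⁅y⁆⇒x≡y; ∈⊤)
open import Data.Integer as ℤ using (ℤ; +_; -[1+_])
open import Data.Nat
  using (ℕ; zero; suc; _≤_; _≤?_; _^_; ∣_-_∣; z≤n; s≤s; NonZero; >-nonZero⁻¹)
open import Data.Nat.Properties using (m^n≢0; ≤-refl; ≤-reflexive; ≤-trans)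
open import Data.Product using (Σ; ∃; _×_; _,_; proj₁; proj₂)
open import Data.Rational as ℚ using (ℚ; 0ℚ; _/_; ↥_; ↧ₙ_)
open import Data.Sum using (_⊎_; inj₁; inj₂)
open import Data.Vec using (Vec; []; _∷_; here; there; count; map)
open import Function using (_∘_)
open import Relation.Binary.PropositionalEquality
  using (_≡_; _≢_; refl; sym; trans; cong)
open import Relation.Nullary using (Dec; yes; no; does; ¬_; contradiction)
open import Relation.Nullary.Decidable
  using (map′; ¬?; _×-dec_; _⊎-dec_; _→-dec_; dec-true; dec-false)
open import Relation.Unary using (Decidable)

private
  variable
    n d : ℕ

-- K_n has vertex set Fin n; its edges are the pairs {u , v} with u ≢ v.

record Biclique (n : ℕ) : Set where
  constructor biclique
  field
    U W       : Subset n
    .disjoint : Empty (U ∩ W)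

open Biclique

Directs : Fin n → Fin n → Biclique n → Set
Directs u v B = u ∈ U B × v ∈ W B

Covers : Fin n → Fin n → Biclique n → Set
Covers u v B = Directs u v B ⊎ Directs v u B

directs? : (u v : Fin n) → Decidable (Directs u v)
directs? u v B = (u ∈? U B) ×-dec (v ∈? W B)

covers? : (u v : Fin n) → Decidable (Covers u v)
covers? u v B = directs? u v B ⊎-dec directs? v u B

-- A collection of size d is an indexed family, so repetitions are allowed.

AlmostBalancedCovering : ℕ → Vec (Biclique n) d → Set
AlmostBalancedCovering {n = n} k C = (u v : Fin n) → u ≢ v →
  (1 ≤ count (covers? u v) C × count (covers? u v) C ≤ k) ×
  ∣ count (directs? u v) C - count (directs? v u) C ∣ ≤ 1

HasCoveringOfSize : (n k d : ℕ) → Set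
HasCoveringOfSize n k d = ∃ λ (C : Vec (Biclique n) d) → AlmostBalancedCovering k C

IsMinimum : (ℕ → Set) → ℕ → Set
IsMinimum P d = P d × (∀ e → P e → d ≤ e)

-- The minimum exists: the search is decidable, and the n stars
-- ({i} , {j ∣ j > i}) form a covering of every order k ≥ 1.

private

  covering? : ∀ k → Decidable (AlmostBalancedCovering {n} {d} k)
  covering? k C = all? λ u → all? λ v → ¬? (u ≟ v) →-dec
    (((1 ≤? count (covers? u v) C) ×-dec (count (covers? u v) C ≤? k)) ×-dec
     (∣ count (directs? u v) C - count (directs? v u) C ∣ ≤? 1))

  anyBiclique? : {P : Biclique n → Set} → Decidable P → Dec (∃ P)
  anyBiclique? {n} {P} P? =
    map′ (λ (U , W , dis , p) → biclique U W dis , p)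
         (λ (biclique U W dis , p) → U , W , (λ ne → ⊥-elim-irr (dis ne)) , p)
         (anySubset? λ U → anySubset? λ W → withDisjoint U W)
    where
    withDisjoint : ∀ U W → Dec (Σ (Empty (U ∩ W)) λ dis → P (biclique U W dis))
    withDisjoint U W with nonempty? (U ∩ W)
    ... | yes ne = no λ (dis , _) → dis ne
    ... | no dis = map′ (dis ,_) proj₂ (P? (biclique U W dis))

  anyVec? : {P : Vec (Biclique n) d → Set} → Decidable P → Dec (∃ P)
  anyVec? {d = zero}  P? = map′ ([] ,_) (λ { ([] , p) → p }) (P? [])
  anyVec? {d = suc d} P? =
    map′ (λ (B , C , p) → B ∷ C , p) (λ { (B ∷ C , p) → B , C , p })
         (anyBiclique? λ B → anyVec? λ C → P? (B ∷ C))

  hasCovering? : ∀ n k → Decidable (HasCoveringOfSize n k)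
  hasCovering? n k d = anyVec? (covering? k)

  minimum : {P : ℕ → Set} → Decidable P → ∀ m → P m → ∃ (IsMinimum P)
  minimum P? m pm with P? 0
  minimum P? m       pm | yes p0 = 0 , p0 , λ _ _ → z≤n
  minimum P? zero    pm | no ¬p0 = contradiction pm ¬p0
  minimum P? (suc m) pm | no ¬p0 with minimum (P? ∘ suc) m pm
  ... | d , pd , least = suc d , pd ,
    λ { zero p0 → contradiction p0 ¬p0 ; (suc e) pe → s≤s (least e pe) }

  firstStar : Biclique (suc n)
  firstStar = biclique ⁅ zero ⁆ (outside ∷ ⊤) λ (x , x∈) → absurd x (x∈p∩q⁻ _ _ x∈)
    where
    absurd : ∀ x → ¬ (x ∈ ⁅ zero ⁆ × x ∈ (outside ∷ ⊤))
    absurd zero    (_ , ())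
    absurd (suc x) (x∈ , _) with () ← x∈⁅y⁆⇒x≡y zero x∈

  lift : Biclique n → Biclique (suc n)
  lift (biclique U W dis) = biclique (outside ∷ U) (outside ∷ W)
    λ { (zero , ()) ; (suc x , there x∈) → dis (x , x∈) }

  stars : ∀ n → Vec (Biclique n) n
  stars zero    = []
  stars (suc n) = firstStar ∷ map lift (stars n)

  count-accept : ∀ {A : Set} {P : A → Set} (P? : Decidable P) {x} {xs : Vec A n} →
                 P x → count P? (x ∷ xs) ≡ suc (count P? xs)
  count-accept P? {x} p rewrite dec-true (P? x) p = refl

  count-reject : ∀ {A : Set} {P : A → Set} (P? : Decidable P) {x} {xs : Vec A n} →
                 ¬ P x → count P? (x ∷ xs) ≡ count P? xs
  count-reject P? {x} ¬p rewrite dec-false (P? x) ¬p = refl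

  count-none : ∀ {P : Biclique (suc n) → Set} (P? : Decidable P) →
               (∀ B → ¬ P (lift B)) → (C : Vec (Biclique n) d) → count P? (map lift C) ≡ 0
  count-none P? none []      = refl
  count-none P? none (B ∷ C) = trans (count-reject P? {lift B} {map lift C} (none B)) (count-none P? none C)

  directs-lift : ∀ (u v : Fin n) (C : Vec (Biclique n) d) →
    count (directs? (suc u) (suc v)) (map lift C) ≡ count (directs? u v) C
  directs-lift u v []      = refl
  directs-lift u v (B ∷ C) with does (directs? u v B)
  ... | true  = cong suc (directs-lift u v C)
  ... | false = directs-lift u v C

  covers-lift : ∀ (u v : Fin n) (C : Vec (Biclique n) d) →
    count (covers? (suc u) (suc v)) (map lift C) ≡ count (covers? u v) C
  covers-lift u v []      = refl
  covers-lift u v (B ∷ C) with does (covers? u v B)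
  ... | true  = cong suc (covers-lift u v C)
  ... | false = covers-lift u v C

  suc∉ : {u : Fin n} → ¬ (suc u ∈ ⁅ zero {n} ⁆)
  suc∉ u∈ with () ← x∈⁅y⁆⇒x≡y zero u∈

  stars-directs : ∀ (u v : Fin n) → count (directs? u v) (stars n) ≤ 1
  stars-directs {suc n} zero zero = ≤-trans (≤-reflexive (trans
    (count-reject (directs? zero zero) {firstStar} {map lift (stars n)} λ { (_ , ()) })
    (count-none (directs? zero zero) (λ { _ (() , _) }) (stars n)))) z≤n
  stars-directs {suc n} zero (suc v) = ≤-reflexive (trans
    (count-accept (directs? zero (suc v)) {firstStar} {map lift (stars n)}
      (here , there ∈⊤))
    (cong suc (count-none (directs? zero (suc v)) (λ { _ (() , _) }) (stars n))))
  stars-directs {suc n} (suc u) zero = ≤-trans (≤-reflexive (trans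
    (count-reject (directs? (suc u) zero) {firstStar} {map lift (stars n)} λ { (_ , ()) })
    (count-none (directs? (suc u) zero) (λ { _ (_ , ()) }) (stars n)))) z≤n
  stars-directs {suc n} (suc u) (suc v) = ≤-trans (≤-reflexive (trans
    (count-reject (directs? (suc u) (suc v)) {firstStar} {map lift (stars n)}
      λ (u∈ , _) → suc∉ u∈)
    (directs-lift u v (stars n)))) (stars-directs u v)

  stars-covers : ∀ (u v : Fin n) → u ≢ v → count (covers? u v) (stars n) ≡ 1
  stars-covers {suc n} zero zero u≢v = contradiction refl u≢v
  stars-covers {suc n} zero (suc v) _ = trans
    (count-accept (covers? zero (suc v)) {firstStar} {map lift (stars n)}
      (inj₁ (here , there ∈⊤)))
    (cong suc (count-none (covers? zero (suc v))
      (λ { _ (inj₁ (() , _)) ; _ (inj₂ (_ , ())) }) (stars n)))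
  stars-covers {suc n} (suc u) zero _ = trans
    (count-accept (covers? (suc u) zero) {firstStar} {map lift (stars n)}
      (inj₂ (here , there ∈⊤)))
    (cong suc (count-none (covers? (suc u) zero)
      (λ { _ (inj₁ (_ , ())) ; _ (inj₂ (() , _)) }) (stars n)))
  stars-covers {suc n} (suc u) (suc v) u≢v = trans
    (count-reject (covers? (suc u) (suc v)) {firstStar} {map lift (stars n)}
      λ { (inj₁ (u∈ , _)) → suc∉ u∈ ; (inj₂ (v∈ , _)) → suc∉ v∈ })
    (trans (covers-lift u v (stars n)) (stars-covers u v (u≢v ∘ cong suc)))

  diff≤1 : ∀ {a b} → a ≤ 1 → b ≤ 1 → ∣ a - b ∣ ≤ 1
  diff≤1 z≤n       b≤1       = b≤1
  diff≤1 (s≤s z≤n) z≤n       = ≤-refl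
  diff≤1 (s≤s z≤n) (s≤s z≤n) = z≤n

  stars-covering : ∀ n k .{{_ : NonZero k}} → HasCoveringOfSize n k n
  stars-covering n k = stars n , λ u v u≢v →
    ( ≤-reflexive (sym (stars-covers u v u≢v))
    , ≤-trans (≤-reflexive (stars-covers u v u≢v)) (>-nonZero⁻¹ k)) ,
    diff≤1 (stars-directs u v) (stars-directs v u)

minimumCovering : ∀ n k .{{_ : NonZero k}} → ∃ (IsMinimum (HasCoveringOfSize n k))
minimumCovering n k = minimum (hasCovering? n k) n (stars-covering n k)

f : (n k : ℕ) .{{_ : NonZero k}} → ℕ
f n k = proj₁ (minimumCovering n k)

f-isMinimum : ∀ n k .{{_ : NonZero k}} → IsMinimum (HasCoveringOfSize n k) (f n k)
f-isMinimum n k = proj₂ (minimumCovering n k)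

-- Rational-valued sequences suffice to express o(1) in an upper bound: every
-- real null sequence is dominated by a rational one.

TendsToZero : (ℕ → ℚ) → Set
TendsToZero g = (η : ℚ) → 0ℚ ℚ.< η → ∃ λ N → ∀ n → N ≤ n → ℚ.∣ g n ∣ ℚ.< η

infixr 8 _^ℚ_ _^ℤ_

_^ℚ_ : ℚ → ℕ → ℚ
_^ℚ_ = pow ℚ.+-*-rawSemiring

_^ℤ_ : (b : ℕ) .{{_ : NonZero b}} → ℤ → ℚ
b ^ℤ (+ m)    = + (b ^ m) / 1
b ^ℤ -[1+ m ] = _/_ (+ 1) (b ^ suc m) {{m^n≢0 b (suc m)}}

-- The real number b ^ (p / q) need not be rational, so the inequality
-- x ≤ y · b ^ (p / q) is stated after raising both sides to the power q ≥ 1.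
-- For y ≥ 0 this is an equivalence; for y < 0 the inequality is false, as x ≥ 0.

infix 4 _≤_·⟨_^_⟩

_≤_·⟨_^_⟩ : ℕ → ℚ → (b : ℕ) .{{_ : NonZero b}} → ℚ → Set
x ≤ y ·⟨ b ^ e ⟩ =
  0ℚ ℚ.≤ y × (+ (x ^ ↧ₙ e) / 1) ℚ.≤ (y ^ℚ ↧ₙ e) ℚ.* (b ^ℤ ↥ e)

{-# OPTIONS --safe #-}
module Submission where

-- Label the vertices by pairs (u , v) of words of length s over an alphabet of p letters. For a
-- place e, direct x to y if v and v′ first differ at e and the letters of u after e are
-- lexicographically larger than those of u′ (ties are broken by v_e). This reads only s letters of
-- x, namely v up to e and u after e, so it costs p^s bicliques, and over all e it directs each pair
-- with v ≢ v′ exactly once. For a place b, direct x to y if u and u′ first differ at b, u_b < u′_b,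
-- and v and v′ agree from b on. This reads s + 1 letters of x, and it directs each pair with
-- v ≡ v′ and u ≢ u′ exactly once. It may also direct a pair with v ≢ v′, but then v and v′ differ
-- only before b, so the first relation compares u and u′ from their first difference b on and
-- directs that pair the other way. Hence n = p^(2s) vertices need O(s p^(s+1)) bicliques for k = 2.
-- A further word of length s, whose different values are directed once each way by p^s bicliques,
-- raises k by 2 and n by the factor p^s, which gives the exponent 1/(⌊k/2⌋+1) + O(1/s). Letting s
-- grow slowly with n turns the error and all constants into n^o(1).

open import Defs
open import Data.Bool using (Bool; true; false; not; _∧_; if_then_else_; T?)
open import Data.Bool.Properties using (∧-zeroʳ; ∧-identityʳ)
open import Data.Empty using (⊥; ⊥-elim-irr)
open import Data.Fin using (Fin; zero; suc; combine; remQuot; inject≤; _≟_; _<?_)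
open import Data.Fin.Properties
  using (remQuot-combine; combine-remQuot; inject≤-injective; <-cmp; <-irrefl)
open import Data.Fin.Subset using (_∈_)
open import Data.Fin.Subset.Properties using (_∈?_; x∈p∩q⁻; x∈p∩q⁺)
open import Data.Integer as ℤ using (+_; -[1+_]; +≤+; +<+)
import Data.Integer.Properties as ℤₚ
open import Data.Nat
  using ( ℕ; zero; suc; pred; _+_; _*_; _^_; ∣_-_∣; _≤_; _≤?_; ⌊_/2⌋; ⌈_/2⌉; NonZero; >-nonZero
        ; z≤n; s≤s; s≤s⁻¹; s<s )
open import Data.Nat.Properties hiding (_≟_; _<?_; <-cmp; <-irrefl)
open import Data.Nat.Tactic.RingSolver using (solve-∀)
open import Data.Product using (Σ; ∃; ∃₂; _×_; _,_; proj₁; proj₂)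
open import Data.Rational as ℚ using (ℚ; mkℚ; 0ℚ; 1ℚ; _/_; *≤*)
import Data.Rational.Properties as ℚₚ
open import Data.Rational.Unnormalised as ℚᵘ using (mkℚᵘ; *≡*; *≤*; *<*)
import Data.Rational.Unnormalised.Properties as ℚᵘₚ
open import Data.Sum using (_⊎_; inj₁; inj₂)
open import Data.Vec using (Vec; []; _∷_; _++_; count; map; head; tail; tabulate)
open import Data.Vec.Properties using (≡-dec; ∷-injective)
open import Function using (_∘_; id; it; Injective)
open import Relation.Binary.Definitions using (tri<; tri≈; tri>)
open import Relation.Binary.PropositionalEquality
  using (_≡_; _≢_; refl; sym; trans; cong; cong₂; subst; subst₂)
open import Relation.Nullary using (Dec; does; yes; no; contradiction)
open import Relation.Nullary.Decidable using (dec-true; dec-false; _⊎-dec_)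
open import Relation.Unary using (Decidable)

-- Counting in collections of bicliques.

indicator : Bool → ℕ
indicator b = if b then 1 else 0

indicator≤1 : ∀ b → indicator b ≤ 1
indicator≤1 true  = ≤-refl
indicator≤1 false = z≤n

module _ {A : Set} {P : A → Set} (P? : Decidable P) where

  count-++ : ∀ {m n} (xs : Vec A m) (ys : Vec A n) →
             count P? (xs ++ ys) ≡ count P? xs + count P? ys
  count-++ []       ys = refl
  count-++ (x ∷ xs) ys with does (P? x)
  ... | true  = cong suc (count-++ xs ys)
  ... | false = count-++ xs ys

  count-tabulate-none : ∀ {m} (g : Fin m → A) → (∀ c → does (P? (g c)) ≡ false) →
                        count P? (tabulate g) ≡ 0
  count-tabulate-none {zero}  g none = refl
  count-tabulate-none {suc m} g none rewrite none zero =
    count-tabulate-none (g ∘ suc) (none ∘ suc)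

  -- Intended for the bicliques of a window: a vertex lies in the first class of only one of them,
  -- the one indexed by its own key `i`.
  count-tabulate-at : ∀ {m} (g : Fin m → A) (h : Fin m → Bool) (i : Fin m) →
                      (∀ c → does (P? (g c)) ≡ does (i ≟ c) ∧ h c) →
                      count P? (tabulate g) ≡ indicator (h i)
  count-tabulate-at g h zero eq rewrite eq zero with h zero
  ... | true  = cong suc (count-tabulate-none (g ∘ suc) (eq ∘ suc))
  ... | false = count-tabulate-none (g ∘ suc) (eq ∘ suc)
  count-tabulate-at g h (suc i) eq rewrite eq zero =
    count-tabulate-at (g ∘ suc) (h ∘ suc) i (eq ∘ suc)

does-∈?-tabulate : ∀ {n} (f : Fin n → Bool) x → does (x ∈? tabulate f) ≡ f x
does-∈?-tabulate f zero with f zero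
... | true  = refl
... | false = refl
does-∈?-tabulate f (suc x) = does-∈?-tabulate (f ∘ suc) x

∈-tabulate⁻ : ∀ {n} (f : Fin n → Bool) x → x ∈ tabulate f → f x ≡ true
∈-tabulate⁻ f x x∈ = trans (sym (does-∈?-tabulate f x)) (dec-true (x ∈? tabulate f) x∈)

directions : ∀ {n d} → Vec (Biclique n) d → Fin n → Fin n → ℕ
directions C u v = count (directs? u v) C

-- Disjointness of the two classes prevents a biclique from directing the same pair both ways, so
-- the two counts add without overlap.
count-covers : ∀ {n d} (u v : Fin n) (C : Vec (Biclique n) d) →
               count (covers? u v) C ≡ directions C u v + directions C v u
count-covers u v [] = refl
count-covers u v (B@(biclique _ _ disjoint) ∷ C) = go (directs? u v B) (directs? v u B)
  where
  go : (p : Dec (Directs u v B)) (q : Dec (Directs v u B)) →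
       (if does (p ⊎-dec q) then suc else id) (count (covers? u v) C) ≡
       (if does p then suc else id) (directions C u v) + (if does q then suc else id) (directions C v u)
  go (yes (u∈U , _)) (yes (_ , u∈W)) = ⊥-elim-irr (disjoint (u , x∈p∩q⁺ (u∈U , u∈W)))
  go (yes _) (no _)  = cong suc (count-covers u v C)
  go (no _)  (yes _) = trans (cong suc (count-covers u v C)) (sym (+-suc _ _))
  go (no _)  (no _)  = count-covers u v C

-- Words over `p` letters as numbers.

module _ {p : ℕ} where

  encode : ∀ {m} → Vec (Fin p) m → Fin (p ^ m)
  encode []       = zero
  encode (a ∷ as) = combine a (encode as)

  decode : ∀ m → Fin (p ^ m) → Vec (Fin p) m
  decode zero    _ = []
  decode (suc m) i = let (a , j) = remQuot (p ^ m) i in a ∷ decode m j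

  decode-encode : ∀ {m} (as : Vec (Fin p) m) → decode m (encode as) ≡ as
  decode-encode []       = refl
  decode-encode {suc m} (a ∷ as) =
    trans (cong (λ (b , j) → b ∷ decode m j) (remQuot-combine {p} {p ^ m} a (encode as)))
          (cong (a ∷_) (decode-encode as))

  encode-decode : ∀ m i → encode (decode m i) ≡ i
  encode-decode zero    zero = refl
  encode-decode (suc m) i    = let (a , j) = remQuot (p ^ m) i in
    trans (cong (combine {p} {p ^ m} a) (encode-decode m j)) (combine-remQuot {p} (p ^ m) i)

  decode-injective : ∀ m → Injective _≡_ _≡_ (decode m)
  decode-injective m {i} {j} eq =
    trans (sym (encode-decode m i)) (trans (cong encode eq) (encode-decode m j))

-- Bicliques built from vertex labels.

-- The size `d` is fixed before the number of vertices and the labelling, and the counts depend on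
-- labels alone. This makes sums and pullbacks of schemes immediate.
record Scheme (L : Set) (d : ℕ) (D : L → L → ℕ) : Set where
  field
    realise : ∀ {n} (ℓ : Fin n → L) →
      Σ (Vec (Biclique n) d) λ C → ∀ u v → directions C u v ≡ D (ℓ u) (ℓ v)

open Scheme

emptyScheme : ∀ {L} → Scheme L 0 (λ _ _ → 0)
emptyScheme .realise ℓ = [] , λ _ _ → refl

infixr 6 _⊕_
_⊕_ : ∀ {L d e D E} → Scheme L d D → Scheme L e E → Scheme L (d + e) (λ x y → D x y + E x y)
(S ⊕ T) .realise ℓ = let (C , eqC) = S .realise ℓ ; (C′ , eqC′) = T .realise ℓ in
  C ++ C′ , λ u v → trans (count-++ (directs? u v) C C′) (cong₂ _+_ (eqC u v) (eqC′ u v))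

pullback : ∀ {L L′ d D} (g : L → L′) → Scheme L′ d D → Scheme L d (λ x y → D (g x) (g y))
pullback g S .realise ℓ = S .realise (g ∘ ℓ)

-- An irreflexive relation that sees only m letters of its first argument is a disjoint union of
-- p ^ m bicliques.
record Window (p : ℕ) (L : Set) (m : ℕ) : Set where
  constructor window
  field
    key    : L → Vec (Fin p) m
    rel    : Vec (Fin p) m → L → Bool
    irrefl : ∀ x → rel (key x) x ≡ false

  holds : L → L → Bool
  holds x y = rel (key x) y

open Window using (holds)

#_ : ∀ {p L m r} → Vec (Window p L m) r → L → L → ℕ
(# ws) x y = count (λ w → T? (holds w x y)) ws

-- The biclique of the word c joins the vertices with key c to the vertices related to c by `rel`;
-- `irrefl` keeps these classes disjoint.
windowScheme : ∀ {p L m} (w : Window p L m) → Scheme L (p ^ m) (λ x y → indicator (holds w x y))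
windowScheme {p} {L} {m} (window key rel irrefl) .realise {n} ℓ = tabulate B , counts
  where
  first second : Fin (p ^ m) → Fin n → Bool
  first c x  = does (encode (key (ℓ x)) ≟ c)
  second c y = rel (decode m c) (ℓ y)

  key-of : ∀ {c x} → first c x ≡ true → decode m c ≡ key (ℓ x)
  key-of {c} {x} eq with encode (key (ℓ x)) ≟ c
  ... | yes refl = decode-encode (key (ℓ x))

  disjoint : ∀ c x → first c x ≡ true → second c x ≡ true → ⊥
  disjoint c x f s rewrite key-of {c} {x} f | irrefl (ℓ x) with () ← s

  B : Fin (p ^ m) → Biclique n
  B c = biclique (tabulate (first c)) (tabulate (second c)) λ (x , x∈) →
    let (x∈U , x∈W) = x∈p∩q⁻ _ _ x∈ in
    disjoint c x (∈-tabulate⁻ (first c) x x∈U) (∈-tabulate⁻ (second c) x x∈W)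

  counts : ∀ u v → directions (tabulate B) u v ≡ indicator (rel (key (ℓ u)) (ℓ v))
  counts u v = trans
    (count-tabulate-at (directs? u v) B (λ c → second c v) (encode (key (ℓ u)))
      (λ c → cong₂ _∧_ (does-∈?-tabulate (first c) u) (does-∈?-tabulate (second c) v)))
    (cong (λ c → indicator (rel c (ℓ v))) (decode-encode (key (ℓ u))))

windowsScheme : ∀ {p L m r} (ws : Vec (Window p L m) r) → Scheme L (r * p ^ m) (# ws)
windowsScheme []       = emptyScheme
windowsScheme (w ∷ ws) .realise ℓ with C , eq ← (windowScheme w ⊕ windowsScheme ws) .realise ℓ =
  C , λ u v → trans (eq u v) (cons (holds w (ℓ u) (ℓ v)) _)
  where
  cons : ∀ b n → indicator b + n ≡ (if b then suc else id) n
  cons true  n = refl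
  cons false n = refl

-- Separating schemes and the adjunction of a word.

record Separating (L : Set) (k d : ℕ) : Set where
  field
    {D}      : L → L → ℕ
    isScheme : Scheme L d D
    zero-diagonal : ∀ x → D x x ≡ 0
    balanced : ∀ {x y} → x ≢ y → (1 ≤ D x y + D y x × D x y + D y x ≤ k) × ∣ D x y - D y x ∣ ≤ 1

open Separating

separating⇒covering : ∀ {L n k k′ d} (ℓ : Fin n → L) → Injective _≡_ _≡_ ℓ → k ≤ k′ →
                      Separating L k d → HasCoveringOfSize n k′ d
separating⇒covering {k′ = k′} ℓ ℓ-inj k≤k′ S = C , λ u v u≢v →
  let ((≥1 , ≤k) , diff) = S .balanced (u≢v ∘ ℓ-inj)
      eq = trans (count-covers u v C) (cong₂ _+_ (eqC u v) (eqC v u))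
  in (subst (1 ≤_) (sym eq) ≥1 , subst (_≤ k′) (sym eq) (≤-trans ≤k k≤k′)) ,
     subst₂ (λ a b → ∣ a - b ∣ ≤ 1) (sym (eqC u v)) (sym (eqC v u)) diff
  where
  C   = S .isScheme .realise ℓ .proj₁
  eqC = S .isScheme .realise ℓ .proj₂

module _ {p : ℕ} where

  infix 4 _≟ᵛ_
  _≟ᵛ_ : ∀ {m} (as bs : Vec (Fin p) m) → Dec (as ≡ bs)
  _≟ᵛ_ = ≡-dec _≟_

  -- Having different heads is a symmetric relation, so it adds one to both directions: the total
  -- grows by 2 and the difference is unchanged. Its window reads the `s` letters of the head.
  addCoordinate : ∀ {s r k d} → Separating (Vec (Vec (Fin p) s) r) k d →
                  Separating (Vec (Vec (Fin p) s) (suc r)) (2 + k) (p ^ s + d)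
  addCoordinate {s} {r} {k} S = record
    { isScheme      = windowScheme differ ⊕ pullback tail (S .isScheme)
    ; zero-diagonal = λ { (a ∷ as) → cong₂ _+_ (cong indicator (not-refl a)) (S .zero-diagonal as) }
    ; balanced      = balanced′
    }
    where
    not-refl : ∀ (a : Vec (Fin p) s) → not (does (a ≟ᵛ a)) ≡ false
    not-refl a = cong not (dec-true (a ≟ᵛ a) refl)

    differ : Window p (Vec (Vec (Fin p) s) (suc r)) s
    differ = window head (λ c y → not (does (c ≟ᵛ head y))) (not-refl ∘ head)

    D′ : (x y : Vec (Vec (Fin p) s) (suc r)) → ℕ
    D′ x y = indicator (holds differ x y) + S .D (tail x) (tail y)

    tail-bounds : ∀ as bs → S .D as bs + S .D bs as ≤ k × ∣ S .D as bs - S .D bs as ∣ ≤ 1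
    tail-bounds as bs with ≡-dec _≟ᵛ_ as bs
    -- Different labels may have equal tails, about which `balanced` says nothing.
    ... | yes refl rewrite S .zero-diagonal as = z≤n , z≤n
    ... | no as≢bs = let ((_ , ≤k) , diff) = S .balanced as≢bs in ≤k , diff

    balanced′ : ∀ {x y} → x ≢ y →
      (1 ≤ D′ x y + D′ y x × D′ x y + D′ y x ≤ 2 + k) × ∣ D′ x y - D′ y x ∣ ≤ 1
    balanced′ {a ∷ as} {b ∷ bs} x≢y with a ≟ᵛ b | b ≟ᵛ a
    ... | yes refl | yes _   = let ((≥1 , ≤k) , diff) = S .balanced (x≢y ∘ cong (a ∷_)) in
      (≥1 , ≤-trans ≤k (m≤n+m k 2)) , diff
    ... | yes a≡b  | no b≢a  = contradiction (sym a≡b) b≢a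
    ... | no a≢b   | yes b≡a = contradiction (sym b≡a) a≢b
    ... | no _     | no _    = let (≤k , diff) = tail-bounds as bs in
      (s≤s z≤n , s≤s (≤-trans (≤-reflexive (+-suc _ _)) (s≤s ≤k))) , diff

  -- Lexicographic comparison with a tie-break.

  -- The Boolean is the verdict when the two words are equal.
  lex : Bool → ∀ {m} → Vec (Fin p) m → Vec (Fin p) m → Bool
  lex b []       []       = b
  lex b (a ∷ as) (c ∷ cs) = if does (a ≟ c) then lex b as cs else does (a <? c)

  <?-total : ∀ {a c : Fin p} → a ≢ c → 1 ≤ indicator (does (a <? c)) + indicator (does (c <? a))
  <?-total {a} {c} a≢c with <-cmp a c
  ... | tri< a<c _ _ rewrite dec-true (a <? c) a<c = s≤s z≤n
  ... | tri≈ _ a≡c _ = contradiction a≡c a≢c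
  ... | tri> _ _ c<a rewrite dec-true (c <? a) c<a = m≤n+m 1 _

  <?-asym : ∀ (a c : Fin p) → indicator (does (a <? c)) + indicator (does (c <? a)) ≤ 1
  <?-asym a c with <-cmp a c
  ... | tri< a<c _ c≮a rewrite dec-true (a <? c) a<c | dec-false (c <? a) c≮a = ≤-refl
  ... | tri≈ a≮c _ c≮a rewrite dec-false (a <? c) a≮c | dec-false (c <? a) c≮a = z≤n
  ... | tri> a≮c _ c<a rewrite dec-false (a <? c) a≮c | dec-true (c <? a) c<a = ≤-refl

  -- The tie-break enters on one side only, so a tie also contributes at most one. The strict side
  -- will bound `Q`, the other side is `P`.
  lex-asym : ∀ b {m} (as cs : Vec (Fin p) m) →
             indicator (lex b as cs) + indicator (lex false cs as) ≤ 1
  lex-asym b []       []       = ≤-trans (≤-reflexive (+-identityʳ _)) (indicator≤1 b)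
  lex-asym b (a ∷ as) (c ∷ cs) with a ≟ c | c ≟ a
  ... | yes _   | yes _   = lex-asym b as cs
  ... | yes a≡c | no c≢a  = contradiction (sym a≡c) c≢a
  ... | no a≢c  | yes c≡a = contradiction (sym c≡a) a≢c
  ... | no _    | no _    = <?-asym a c

  lex-total : ∀ {b b′} → 1 ≤ indicator b + indicator b′ → ∀ {m} (as cs : Vec (Fin p) m) →
              1 ≤ indicator (lex b as cs) + indicator (lex b′ cs as)
  lex-total 1≤ []       []       = 1≤
  lex-total 1≤ (a ∷ as) (c ∷ cs) with a ≟ c | c ≟ a
  ... | yes _   | yes _   = lex-total 1≤ as cs
  ... | yes a≡c | no c≢a  = contradiction (sym a≡c) c≢a
  ... | no a≢c  | yes c≡a = contradiction (sym c≡a) a≢c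
  ... | no a≢c  | no _    = <?-total a≢c

  -- The windows at the successive places of two words.

  -- Moves a window one place further: the letter `a` is added to the key and must agree, and `t`
  -- discards the place passed over.
  refine : ∀ {L L′ m} (a : L → Fin p) (t : L → L′) → Window p L′ m → Window p L (suc m)
  refine a t w = window
    (λ x → a x ∷ key (t x))
    (λ c y → does (head c ≟ a y) ∧ rel (tail c) (t y))
    (λ x → trans (cong (does (a x ≟ a x) ∧_) (irrefl (t x))) (∧-zeroʳ _))
    where open Window w

  #-refine : ∀ {L L′ m r} (a : L → Fin p) (t : L → L′) (ws : Vec (Window p L′ m) r) x y →
             (# map (refine a t) ws) x y ≡ (if does (a x ≟ a y) then (# ws) (t x) (t y) else 0)
  #-refine a t [] x y with does (a x ≟ a y)
  ... | true  = refl
  ... | false = refl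
  #-refine a t (w ∷ ws) x y rewrite #-refine a t ws x y with does (a x ≟ a y)
  ... | true  = refl
  ... | false = refl

  Pair : ℕ → Set
  Pair s = Vec (Fin p) s × Vec (Fin p) s

  tails : ∀ {s} → Pair (suc s) → Pair s
  tails (u , v) = tail u , tail v

  -- The relation for v-words that differ at the current place. The letter of u at this place is not
  -- read, which pays for reading that of v. `lex` has y on its left, so x is directed to y when x
  -- has the larger rest of u.
  P₀ : ∀ {s} → Window p (Pair (suc s)) (suc s)
  P₀ = window
    (λ (u , v) → head v ∷ tail u)
    (λ c (u , v) → not (does (head c ≟ head v)) ∧ lex (does (head v <? head c)) (tail u) (tail c))
    (λ (u , v) → cong (λ b → not b ∧ lex (does (head v <? head v)) (tail u) (tail u))
                      (dec-true (head v ≟ head v) refl))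

  -- The v-words are compared only from the current place on: refinement drops the earlier letters
  -- of v unread, which keeps the key at one letter more than the word length.
  Q₀ : ∀ {s} → Window p (Pair (suc s)) (suc (suc s))
  Q₀ = window
    (λ (u , v) → head u ∷ v)
    (λ c (u , v) → does (head c <? head u) ∧ does (tail c ≟ᵛ v))
    (λ (u , v) → cong (_∧ does (v ≟ᵛ v)) (dec-false (head u <? head u) (<-irrefl refl)))

  P : ∀ s → Vec (Window p (Pair s) s) s
  P zero    = []
  P (suc s) = P₀ ∷ map (refine (head ∘ proj₂) tails) (P s)

  Q : ∀ s → Vec (Window p (Pair s) (suc s)) s
  Q zero    = []
  Q (suc s) = Q₀ ∷ map (refine (head ∘ proj₁) tails) (Q s)

  -- The cases exclude each other: `P₀` demands different first letters of the v-words, every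
  -- refined window demands equal ones. The inductions below run on this recursion and on `#Q-∷`.
  #P-∷ : ∀ {s} {u w v z} {us ws vs zs : Vec (Fin p) s} →
    (# P (suc s)) (u ∷ us , v ∷ vs) (w ∷ ws , z ∷ zs) ≡
    (if does (v ≟ z) then (# P s) (us , vs) (ws , zs) else indicator (lex (does (z <? v)) ws us))
  #P-∷ {s} {u} {w} {v} {z} {us} {ws} {vs} {zs}
    rewrite #-refine (head ∘ proj₂) tails (P s) (u ∷ us , v ∷ vs) (w ∷ ws , z ∷ zs) with does (v ≟ z)
  ... | true  = refl
  ... | false with lex (does (z <? v)) ws us
  ...   | true  = refl
  ...   | false = refl

  #Q-∷ : ∀ {s} {u w v z} {us ws vs zs : Vec (Fin p) s} →
    (# Q (suc s)) (u ∷ us , v ∷ vs) (w ∷ ws , z ∷ zs) ≡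
    (if does (u ≟ w) then (# Q s) (us , vs) (ws , zs)
     else indicator (does (u <? w) ∧ does (v ∷ vs ≟ᵛ z ∷ zs)))
  #Q-∷ {s} {u} {w} {v} {z} {us} {ws} {vs} {zs}
    rewrite #-refine (head ∘ proj₁) tails (Q s) (u ∷ us , v ∷ vs) (w ∷ ws , z ∷ zs) with u ≟ w
  ... | yes refl rewrite dec-false (u <? u) (<-irrefl refl) = refl
  ... | no _ with does (u <? w) ∧ does (v ∷ vs ≟ᵛ z ∷ zs)
  ...   | true  = refl
  ...   | false = refl

  indicator-∧ˡ : ∀ b c → indicator (b ∧ c) ≤ indicator b
  indicator-∧ˡ true  c = indicator≤1 c
  indicator-∧ˡ false c = z≤n

  #P-same : ∀ {s} (us ws vs : Vec (Fin p) s) → (# P s) (us , vs) (ws , vs) ≡ 0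
  #P-same []       []       []       = refl
  #P-same {suc s} (u ∷ us) (w ∷ ws) (v ∷ vs) rewrite #P-∷ {s} {u} {w} {v} {v} {us} {ws} {vs} {vs}
    | dec-true (v ≟ v) refl = #P-same us ws vs

  #P≤1 : ∀ {s} (us ws vs zs : Vec (Fin p) s) → (# P s) (us , vs) (ws , zs) ≤ 1
  #P≤1 []       []       []       []       = z≤n
  #P≤1 {suc s} (u ∷ us) (w ∷ ws) (v ∷ vs) (z ∷ zs) rewrite #P-∷ {s} {u} {w} {v} {z} {us} {ws} {vs} {zs}
    with v ≟ z
  ... | yes _ = #P≤1 us ws vs zs
  ... | no _  = indicator≤1 (lex (does (z <? v)) ws us)

  -- A window of `Q` acts at the first difference of the u-words and directs the smaller word to the
  -- larger, opposite to the preference of `P`.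
  #Q≤lex : ∀ {s} (us ws vs zs : Vec (Fin p) s) → (# Q s) (us , vs) (ws , zs) ≤ indicator (lex false us ws)
  #Q≤lex []       []       []       []       = z≤n
  #Q≤lex {suc s} (u ∷ us) (w ∷ ws) (v ∷ vs) (z ∷ zs) rewrite #Q-∷ {s} {u} {w} {v} {z} {us} {ws} {vs} {zs}
    with u ≟ w
  ... | yes _ = #Q≤lex us ws vs zs
  ... | no _  = indicator-∧ˡ (does (u <? w)) _

  -- The crux: `P` and `Q` never direct the same pair the same way. Both may act on one pair, but
  -- then in opposite directions.
  directed-once : ∀ {s} (us ws vs zs : Vec (Fin p) s) →
                  (# P s) (us , vs) (ws , zs) + (# Q s) (us , vs) (ws , zs) ≤ 1
  directed-once []       []       []       []       = z≤n
  directed-once {suc s} (u ∷ us) (w ∷ ws) (v ∷ vs) (z ∷ zs)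
    rewrite #P-∷ {s} {u} {w} {v} {z} {us} {ws} {vs} {zs} | #Q-∷ {s} {u} {w} {v} {z} {us} {ws} {vs} {zs}
    with v ≟ z | u ≟ w
  ... | yes _ | yes _ = directed-once us ws vs zs
  -- `P` acts at this place and asks for the larger rest of u, whereas `Q` can act only later and
  -- asks for the smaller.
  ... | no _ | yes _ = ≤-trans (+-monoʳ-≤ _ (#Q≤lex us ws vs zs)) (lex-asym (does (z <? v)) ws us)
  -- `Q` could act only at this place, but the v-words already differ here.
  ... | no _ | no _ rewrite ∧-zeroʳ (does (u <? w)) =
    ≤-trans (≤-reflexive (+-identityʳ _)) (indicator≤1 (lex (does (z <? v)) ws us))
  -- Again `Q` can act only here. It needs equal v-words, and for these `P` is silent.
  ... | yes _ | no _ with vs ≟ᵛ zs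
  ...   | yes refl rewrite #P-same us ws vs = indicator≤1 (does (u <? w) ∧ true)
  ...   | no _ rewrite ∧-zeroʳ (does (u <? w)) =
    ≤-trans (≤-reflexive (+-identityʳ _)) (#P≤1 us ws vs zs)

  #P-total : ∀ {s} (us ws vs zs : Vec (Fin p) s) → vs ≢ zs →
             1 ≤ (# P s) (us , vs) (ws , zs) + (# P s) (ws , zs) (us , vs)
  #P-total []       []       []       []       vs≢zs = contradiction refl vs≢zs
  #P-total {suc s} (u ∷ us) (w ∷ ws) (v ∷ vs) (z ∷ zs) vs≢zs
    rewrite #P-∷ {s} {u} {w} {v} {z} {us} {ws} {vs} {zs} | #P-∷ {s} {w} {u} {z} {v} {ws} {us} {zs} {vs}
    with v ≟ z | z ≟ v
  ... | yes refl | yes _   = #P-total us ws vs zs (vs≢zs ∘ cong (v ∷_))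
  ... | yes v≡z  | no z≢v  = contradiction (sym v≡z) z≢v
  ... | no v≢z   | yes z≡v = contradiction (sym z≡v) v≢z
  -- If the remaining u-words tie, the two tie-breaks compare different letters, so one of them
  -- succeeds.
  ... | no v≢z   | no z≢v  = lex-total (<?-total z≢v) ws us

  #Q-total : ∀ {s} (us ws vs : Vec (Fin p) s) → us ≢ ws →
             1 ≤ (# Q s) (us , vs) (ws , vs) + (# Q s) (ws , vs) (us , vs)
  #Q-total []       []       []       us≢ws = contradiction refl us≢ws
  #Q-total {suc s} (u ∷ us) (w ∷ ws) (v ∷ vs) us≢ws
    rewrite #Q-∷ {s} {u} {w} {v} {v} {us} {ws} {vs} {vs} | #Q-∷ {s} {w} {u} {v} {v} {ws} {us} {vs} {vs}
    | dec-true (v ∷ vs ≟ᵛ v ∷ vs) refl | ∧-identityʳ (does (u <? w)) | ∧-identityʳ (does (w <? u))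
    with u ≟ w | w ≟ u
  ... | yes refl | yes _   = #Q-total us ws vs (us≢ws ∘ cong (u ∷_))
  ... | yes u≡w  | no w≢u  = contradiction (sym u≡w) w≢u
  ... | no u≢w   | yes w≡u = contradiction (sym w≡u) u≢w
  ... | no u≢w   | no _    = <?-total u≢w

  -- By `directed-once` each direction counts at most 1, which bounds both the total by 2 and the
  -- difference by 1. Coverage comes from `P` when the v-words differ and from `Q` when they agree.
  twoWords : ∀ s → Separating (Vec (Vec (Fin p) s) 2) 2 (s * p ^ s + s * p ^ suc s)
  twoWords s = record
    { isScheme      = pullback words (windowsScheme (P s) ⊕ windowsScheme (Q s))
    ; zero-diagonal = λ x → cong₂ _+_ (#-diagonal (P s) (words x)) (#-diagonal (Q s) (words x))
    ; balanced      = balanced′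
    }
    where
    words : Vec (Vec (Fin p) s) 2 → Pair s
    words (u ∷ v ∷ []) = u , v

    #-diagonal : ∀ {L m r} (ws : Vec (Window p L m) r) x → (# ws) x x ≡ 0
    #-diagonal []       x = refl
    #-diagonal (w ∷ ws) x rewrite Window.irrefl w x = #-diagonal ws x

    T : Pair s → Pair s → ℕ
    T x y = (# P s) x y + (# Q s) x y

    covered : ∀ us ws vs zs → (us , vs) ≢ (ws , zs) → 1 ≤ T (us , vs) (ws , zs) + T (ws , zs) (us , vs)
    covered us ws vs zs x≢y with vs ≟ᵛ zs
    ... | no vs≢zs = ≤-trans (#P-total us ws vs zs vs≢zs)
      (+-mono-≤ (m≤m+n ((# P s) (us , vs) (ws , zs)) _) (m≤m+n ((# P s) (ws , zs) (us , vs)) _))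
    ... | yes refl = ≤-trans (#Q-total us ws vs (x≢y ∘ cong (_, vs)))
      (+-mono-≤ (m≤n+m _ ((# P s) (us , vs) (ws , vs))) (m≤n+m _ ((# P s) (ws , vs) (us , vs))))

    ∣-∣≤1 : ∀ {a b} → a ≤ 1 → b ≤ 1 → ∣ a - b ∣ ≤ 1
    ∣-∣≤1 z≤n       b≤1       = b≤1
    ∣-∣≤1 (s≤s z≤n) z≤n       = ≤-refl
    ∣-∣≤1 (s≤s z≤n) (s≤s z≤n) = z≤n

    balanced′ : ∀ {x y} → x ≢ y → let T′ = λ a b → T (words a) (words b) in
      (1 ≤ T′ x y + T′ y x × T′ x y + T′ y x ≤ 2) × ∣ T′ x y - T′ y x ∣ ≤ 1
    balanced′ {us ∷ vs ∷ []} {ws ∷ zs ∷ []} x≢y =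
      (covered us ws vs zs (λ eq → x≢y (cong₂ (λ a b → a ∷ b ∷ []) (cong proj₁ eq) (cong proj₂ eq))) ,
       +-mono-≤ once once′) , ∣-∣≤1 once once′
      where
      once  = directed-once us ws vs zs
      once′ = directed-once ws us zs vs

-- From separating schemes to bounds on `f`.

coordinates : ∀ {p s r k d} m → Separating (Vec (Vec (Fin p) s) r) k d →
              Separating (Vec (Vec (Fin p) s) (m + r)) (m * 2 + k) (m * p ^ s + d)
coordinates zero    S = S
coordinates {p} {s} {r} {k} {d} (suc m) S =
  subst (Separating _ _) (sym (+-assoc (p ^ s) (m * p ^ s) d)) (addCoordinate (coordinates m S))

map-injective : ∀ {A B : Set} {g : A → B} → Injective _≡_ _≡_ g →
                ∀ {m} → Injective _≡_ _≡_ (map {n = m} g)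
map-injective g-inj {x = []}    {[]}    eq = refl
map-injective g-inj {x = _ ∷ _} {_ ∷ _} eq =
  cong₂ _∷_ (g-inj (proj₁ (∷-injective eq))) (map-injective g-inj (proj₂ (∷-injective eq)))

separating⇒f≤ : ∀ {p s r k k′ d n} .{{_ : NonZero k′}} → n ≤ (p ^ s) ^ r → k ≤ k′ →
                Separating (Vec (Vec (Fin p) s) r) k d → f n k′ ≤ d
separating⇒f≤ {p} {s} {r} {k′ = k′} {d} {n} n≤ k≤k′ S =
  proj₂ (f-isMinimum n k′) d (separating⇒covering
    -- A vertex is read as `r` digits in base `p ^ s`, and each digit as a word of `s` letters.
    (map (decode s) ∘ decode r ∘ λ i → inject≤ i n≤)
    (inject≤-injective n≤ n≤ _ _ ∘ decode-injective r ∘ map-injective (decode-injective s)) k≤k′ S)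

-- Serves those n for which no word length reaches its threshold. The label is one word of one
-- letter over n letters.
f≤n : ∀ n k .{{_ : NonZero k}} → 2 ≤ k → f n k ≤ n
f≤n n k 2≤k = ≤-trans (separating⇒f≤ (≤-reflexive (sym n^1^1≡n)) 2≤k (addCoordinate {n} {1} nothing))
                      (≤-reflexive (trans (+-identityʳ _) (*-identityʳ n)))
  where
  n^1^1≡n : (n ^ 1) ^ 1 ≡ n
  n^1^1≡n = trans (*-identityʳ (n ^ 1)) (*-identityʳ n)

  nothing : Separating (Vec (Vec (Fin n) 1) 0) 0 0
  nothing = record
    { isScheme      = emptyScheme
    ; zero-diagonal = λ _ → refl
    ; balanced      = λ { {[]} {[]} x≢y → contradiction refl x≢y }
    }

-- The alphabet size for a given word length.

^-distribʳ-* : ∀ a b n → (a * b) ^ n ≡ a ^ n * b ^ n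
^-distribʳ-* a b zero    = refl
^-distribʳ-* a b (suc n) = trans (cong (a * b *_) (^-distribʳ-* a b n)) (interchange a b (a ^ n) (b ^ n))
  where
  interchange : ∀ a b c d → a * b * (c * d) ≡ a * c * (b * d)
  interchange = solve-∀

^-cancelʳ-≤ : ∀ {a b} m .{{_ : NonZero m}} → a ^ m ≤ b ^ m → a ≤ b
^-cancelʳ-≤ m a^m≤b^m = ≮⇒≥ (≤⇒≯ a^m≤b^m ∘ ^-monoˡ-< m)

-- Induction on n, raising `p` by one only when its power falls short. At that moment the old power
-- is at most the old n, and `suc p` is at most `2 * p`, which costs the factor `2 ^ R`.
approximateRoot : ∀ R n .{{_ : NonZero R}} .{{_ : NonZero n}} →
                  ∃ λ p → 1 ≤ p × n ≤ p ^ R × p ^ R ≤ 2 ^ R * n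
approximateRoot R 1 = 1 , ≤-refl , ≤-reflexive (sym (^-zeroˡ R)) ,
  ≤-trans (≤-reflexive (^-zeroˡ R)) (*-mono-≤ (m^n>0 2 R) ≤-refl)
approximateRoot R (suc n@(suc _)) with approximateRoot R n
... | p , 1≤p , n≤p^R , p^R≤ with suc n ≤? p ^ R
...   | yes 1+n≤ = p , 1≤p , 1+n≤ , ≤-trans p^R≤ (*-monoʳ-≤ (2 ^ R) (n≤1+n n))
...   | no 1+n≰  = suc p , s≤s z≤n , ≤-trans (s≤s n≤p^R) (^-monoˡ-< R (n<1+n p)) , (begin
  suc p ^ R       ≤⟨ ^-monoˡ-≤ R (+-mono-≤ 1≤p (m≤m+n p 0)) ⟩
  (2 * p) ^ R     ≡⟨ ^-distribʳ-* 2 p R ⟩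
  2 ^ R * p ^ R   ≤⟨ *-monoʳ-≤ (2 ^ R) (≤-trans (s≤s⁻¹ (≰⇒> 1+n≰)) (n≤1+n n)) ⟩
  2 ^ R * suc n   ∎)
  where
  open ≤-Reasoning

-- Counts the blocks of at most `p ^ suc s` bicliques: one for each of the `m` further words and one
-- for each place in `P` and in `Q`.
coefficient : ℕ → ℕ → ℕ
coefficient m s = m + (s + s)

-- The whole constant factor in the bound on the power of `f`; once n reaches it, a single further
-- factor n absorbs it.
threshold : ℕ → ℕ → ℕ
threshold m s = coefficient m s ^ (s * (m + 2)) * (2 ^ (s * (m + 2))) ^ suc s

-- A label has R = s(m+2) letters, so `p` is taken near the R-th root of n. Dividing the final
-- exponent by R gives 1/(m+2) + 1/s.
f-power-bound : ∀ k m s n .{{_ : NonZero k}} .{{_ : NonZero s}} .{{_ : NonZero n}} →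
                m * 2 + 2 ≤ k → threshold m s ≤ n → f n k ^ (s * (m + 2)) ≤ n ^ (s + (m + 2))
f-power-bound k m s n ≤k threshold≤n = begin
  f n k ^ R                                 ≤⟨ ^-monoˡ-≤ R f≤ ⟩
  (K * p ^ suc s) ^ R                       ≡⟨ ^-distribʳ-* K (p ^ suc s) R ⟩
  K ^ R * (p ^ suc s) ^ R                   ≡⟨ cong (K ^ R *_) (^-^-comm p (suc s) R) ⟩
  K ^ R * (p ^ R) ^ suc s                   ≤⟨ *-monoʳ-≤ (K ^ R) (^-monoˡ-≤ (suc s) p^R≤) ⟩
  K ^ R * (2 ^ R * n) ^ suc s               ≡⟨ cong (K ^ R *_) (^-distribʳ-* (2 ^ R) n (suc s)) ⟩
  K ^ R * ((2 ^ R) ^ suc s * n ^ suc s)     ≡⟨ *-assoc (K ^ R) _ _ ⟨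
  threshold m s * n ^ suc s                 ≤⟨ *-monoˡ-≤ (n ^ suc s) threshold≤n ⟩
  -- The exponent is enlarged so that its quotient by `R` is exactly a sum of two reciprocals.
  n ^ suc (suc s)                           ≤⟨ ^-monoʳ-≤ n 2+s≤ ⟩
  n ^ (s + (m + 2))                         ∎
  where
  open ≤-Reasoning
  R = s * (m + 2)
  K = coefficient m s

  instance
    R≢0 : NonZero R
    R≢0 = m*n≢0 s (m + 2) {{it}} {{>-nonZero (≤-trans (s≤s z≤n) (m≤n+m 2 m))}}

  root = approximateRoot R n
  p    = proj₁ root
  1≤p  = proj₁ (proj₂ root)
  p^R≤ = proj₂ (proj₂ (proj₂ root))

  ^-^-comm : ∀ a b c → (a ^ b) ^ c ≡ (a ^ c) ^ b
  ^-^-comm a b c = trans (^-*-assoc a b c) (trans (cong (a ^_) (*-comm b c)) (sym (^-*-assoc a c b)))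

  2+s≤ : suc (suc s) ≤ s + (m + 2)
  2+s≤ = ≤-trans (≤-reflexive (+-comm 2 s)) (+-monoʳ-≤ s (m≤n+m 2 m))

  n≤ : n ≤ (p ^ s) ^ (m + 2)
  n≤ = ≤-trans (proj₁ (proj₂ (proj₂ root))) (≤-reflexive (sym (^-*-assoc p s (m + 2))))

  p^s≤ : p ^ s ≤ p ^ suc s
  p^s≤ = ≤-trans (≤-reflexive (sym (*-identityˡ (p ^ s)))) (*-monoˡ-≤ (p ^ s) 1≤p)

  f≤ : f n k ≤ K * p ^ suc s
  f≤ = begin
    f n k                                             ≤⟨ separating⇒f≤ n≤ ≤k (coordinates m (twoWords s)) ⟩
    m * p ^ s + (s * p ^ s + s * p ^ suc s)           ≤⟨ +-mono-≤ (*-monoʳ-≤ m p^s≤)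
                                                           (+-monoˡ-≤ (s * p ^ suc s) (*-monoʳ-≤ s p^s≤)) ⟩
    m * p ^ suc s + (s * p ^ suc s + s * p ^ suc s)   ≡⟨ collect m s (p ^ suc s) ⟩
    K * p ^ suc s                                     ∎
    where
    collect : ∀ m s x → m * x + (s * x + s * x) ≡ (m + (s + s)) * x
    collect = solve-∀

-- Letting the word length grow with n.

module Inverse (B : ℕ → ℕ) where

  search : ℕ → ℕ → ℕ
  search n zero    = 0
  search n (suc j) with B (suc j) ≤? n
  ... | yes _ = suc j
  ... | no _  = search n j

  search-bound : ∀ n j → search n j ≡ 0 ⊎ B (search n j) ≤ n
  search-bound n zero    = inj₁ refl
  search-bound n (suc j) with B (suc j) ≤? n
  ... | yes B≤n = inj₂ B≤n
  ... | no _    = search-bound n j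

  search-maximal : ∀ n i j → j ≤ i → B j ≤ n → j ≤ search n i
  search-maximal n zero    zero    _   _ = z≤n
  search-maximal n (suc i) j       j≤1+i B≤n with B (suc i) ≤? n
  ... | yes _ = j≤1+i
  ... | no B≰n with m≤n⇒m<n∨m≡n j≤1+i
  ...   | inj₁ (s≤s j≤i) = search-maximal n i j j≤i B≤n
  ...   | inj₂ refl      = contradiction B≤n B≰n

  -- The largest j ≤ n such that B j ≤ n, but 0 if there is none.
  inverse : ℕ → ℕ
  inverse n = search n n

  -- The sum secures both requirements: j lies in the range searched, and `B j` is at most n.
  inverse-unbounded : ∀ j n → j + B j ≤ n → j ≤ inverse n
  inverse-unbounded j n ≤n =
    search-maximal n n j (≤-trans (m≤m+n j (B j)) ≤n) (≤-trans (m≤n+m (B j) j) ≤n)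

reciprocal-null : (g : ℕ → ℕ) → (∀ j → ∃ λ N → ∀ n → N ≤ n → j ≤ g n) →
                  TendsToZero (λ n → + 1 / suc (g n))
reciprocal-null g unbounded (mkℚ -[1+ _ ] _ _) (ℚ.*<* ())
reciprocal-null g unbounded (mkℚ (+ zero) _ _) (ℚ.*<* (+<+ ()))
reciprocal-null g unbounded η@(mkℚ (+ suc a) d _) _ =
  -- Here η is (a+1)/(d+1), so `suc d ≤ g n` already makes the reciprocal smaller than 1/(d+1).
  let (N , d<g) = unbounded (suc d) in N , λ n N≤n →
  subst (ℚ._< η)
    (sym (ℚₚ.0≤p⇒∣p∣≡p (ℚₚ.nonNegative⁻¹ _ {{ℚₚ.normalize-nonNeg 1 (suc (g n))}})))
    (ℚₚ.toℚᵘ-cancel-< (ℚᵘₚ.<-respˡ-≃ (ℚᵘₚ.≃-sym (ℚₚ.toℚᵘ-fromℚᵘ (mkℚᵘ (+ 1) (g n))))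
      (*<* (+<+ (s<s (≤-trans (s≤s (≤-reflexive (+-identityʳ d)))
        (≤-trans (d<g n N≤n) (m≤m+n (g n) _))))))))

-- Rational exponents.

1^ℚ : ∀ q → 1ℚ ^ℚ q ≡ 1ℚ
1^ℚ zero    = refl
1^ℚ (suc q) = trans (ℚₚ.*-identityˡ _) (1^ℚ q)

/1-mono-≤ : ∀ {x y} → x ≤ y → (+ x / 1) ℚ.≤ (+ y / 1)
/1-mono-≤ {x} {y} x≤y = ℚₚ.toℚᵘ-cancel-≤
  (ℚᵘₚ.≤-respˡ-≃ (ℚᵘₚ.≃-sym (ℚₚ.toℚᵘ-fromℚᵘ (mkℚᵘ (+ x) 0)))
  (ℚᵘₚ.≤-respʳ-≃ (ℚᵘₚ.≃-sym (ℚₚ.toℚᵘ-fromℚᵘ (mkℚᵘ (+ y) 0)))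
    (*≤* (ℤₚ.*-monoʳ-≤-nonNeg (+ 1) (+≤+ x≤y)))))

-- The exponent `e` is stored in lowest terms, while the bound comes with an unreduced fraction.
-- Raising the bound to the reduced denominator allows the power `suc m` to be cancelled.
power-bound⇒≤ : ∀ {x b a m} .{{_ : NonZero b}} (e : ℚ) → ℚ.toℚᵘ e ℚᵘ.≃ mkℚᵘ (+ a) m →
                x ^ suc m ≤ b ^ a → x ≤ 1ℚ ·⟨ b ^ e ⟩
power-bound⇒≤ {x} {b} {a} {m} (mkℚ (+ t) d _) (*≡* eq) x^m≤b^a = *≤* (+≤+ z≤n) ,
  subst ((+ (x ^ suc d) / 1) ℚ.≤_)
    (sym (trans (cong (ℚ._* (+ (b ^ t) / 1)) (1^ℚ (suc d))) (ℚₚ.*-identityˡ (+ (b ^ t) / 1))))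
    (/1-mono-≤ {x ^ suc d} {b ^ t} (^-cancelʳ-≤ {x ^ suc d} {b ^ t} (suc m) (begin
      (x ^ suc d) ^ suc m  ≡⟨ ^-*-assoc x (suc d) (suc m) ⟩
      x ^ (suc d * suc m)  ≡⟨ cong (x ^_) (*-comm (suc d) (suc m)) ⟩
      x ^ (suc m * suc d)  ≡⟨ ^-*-assoc x (suc m) (suc d) ⟨
      (x ^ suc m) ^ suc d  ≤⟨ ^-monoˡ-≤ (suc d) x^m≤b^a ⟩
      (b ^ a) ^ suc d      ≡⟨ ^-*-assoc b a (suc d) ⟩
      b ^ (a * suc d)      ≡⟨ cong (b ^_) a*d≡t*m ⟩
      b ^ (t * suc m)      ≡⟨ ^-*-assoc b t (suc m) ⟨
      (b ^ t) ^ suc m      ∎)))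
  where
  open ≤-Reasoning
  a*d≡t*m : a * suc d ≡ t * suc m
  a*d≡t*m = ℤₚ.+-injective
    (trans (ℤₚ.pos-* a (suc d)) (trans (sym eq) (sym (ℤₚ.pos-* t (suc m)))))
power-bound⇒≤ {a = zero}  (mkℚ -[1+ t ] d _) (*≡* ()) _
power-bound⇒≤ {a = suc a} (mkℚ -[1+ t ] d _) (*≡* ()) _

-- The right side is deliberately unreduced, to match the exponents of `f-power-bound`; `pred`
-- appears because `mkℚᵘ` takes the denominator less one.
reciprocal-sum : ∀ h j → ℚ.toℚᵘ (+ 1 / suc h ℚ.+ + 1 / suc j) ℚᵘ.≃
                 mkℚᵘ (+ (suc j + suc h)) (pred (suc h * suc j))
reciprocal-sum h j = ℚᵘₚ.≃-trans (ℚₚ.toℚᵘ-homo-+ (+ 1 / suc h) (+ 1 / suc j))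
  (ℚᵘₚ.≃-trans (ℚᵘₚ.+-cong (ℚₚ.toℚᵘ-fromℚᵘ (mkℚᵘ (+ 1) h)) (ℚₚ.toℚᵘ-fromℚᵘ (mkℚᵘ (+ 1) j)))
    (*≡* (cong (ℤ._* + (suc h * suc j))
      (cong₂ ℤ._+_ (ℤₚ.*-identityˡ (+ suc j)) (ℤₚ.*-identityˡ (+ suc h))))))

theorem2 : (k : ℕ) .{{_ : NonZero k}} → 2 ≤ k →
    ∃ λ (c₂ : ℚ) → 0ℚ ℚ.< c₂ ×
    (∃₂ λ (ε δ : ℕ → ℚ) → TendsToZero ε × TendsToZero δ ×
    ((n : ℕ) .{{_ : NonZero n}} →
    f n k ≤ (1ℚ ℚ.+ ε n) ℚ.* c₂ ·⟨ n ^ (+ 1 / suc ⌊ k /2⌋) ℚ.+ δ n ⟩))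
theorem2 k@(suc (suc k′)) 2≤k@(s≤s (s≤s _)) =
  -- All constants are absorbed by the null term in the exponent, so the constant is 1 and the
  -- factor error is 0.
  1ℚ , ℚₚ.positive⁻¹ 1ℚ , (λ _ → 0ℚ) , (λ n → + 1 / suc (inverse n)) ,
  (λ η 0<η → 0 , λ _ _ → 0<η) ,
  reciprocal-null inverse (λ j → _ , inverse-unbounded j) ,
  λ n → power-bound⇒≤ {f n k} {n} {suc (inverse n) + suc (suc m)} {pred (suc (suc m) * suc (inverse n))}
    (+ 1 / suc (suc m) ℚ.+ + 1 / suc (inverse n)) (reciprocal-sum (suc m) (inverse n)) (bound n)
  where
  m = ⌊ k′ /2⌋

  -- The word length is one more than the index found, hence positive.
  open Inverse (threshold m ∘ suc)

  m*2+2≤k : m * 2 + 2 ≤ k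
  m*2+2≤k = begin
    m * 2 + 2                    ≡⟨ double m ⟩
    2 + (m + m)                  ≤⟨ +-monoʳ-≤ 2 (+-monoʳ-≤ m (⌊n/2⌋≤⌈n/2⌉ k′)) ⟩
    2 + (⌊ k′ /2⌋ + ⌈ k′ /2⌉)    ≡⟨ cong (λ i → suc (suc i)) (⌊n/2⌋+⌈n/2⌉≡n k′) ⟩
    k                            ∎
    where
    open ≤-Reasoning
    double : ∀ m → m * 2 + 2 ≡ 2 + (m + m)
    double = solve-∀

  bound : ∀ n .{{_ : NonZero n}} → f n k ^ (suc (suc m) * suc (inverse n)) ≤
                                n ^ (suc (inverse n) + suc (suc m))
  bound n with inverse n | search-bound n n
  ... | j | inj₂ B≤n = subst₂ _≤_
    (cong (f n k ^_) (trans (cong (suc j *_) (+-comm m 2)) (*-comm (suc j) (2 + m))))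
    (cong (λ r → n ^ (suc j + r)) (+-comm m 2))
    (f-power-bound k m (suc j) n m*2+2≤k B≤n)
  -- With the default index 0 the exponent is 1/(m+2) + 1, so the bound by n suffices.
  ... | .0 | inj₁ refl = begin
    f n k ^ (suc (suc m) * 1)    ≡⟨ cong (f n k ^_) (*-identityʳ (suc (suc m))) ⟩
    f n k ^ suc (suc m)          ≤⟨ ^-monoˡ-≤ (suc (suc m)) (f≤n n k 2≤k) ⟩
    n ^ suc (suc m)              ≤⟨ ^-monoʳ-≤ n (n≤1+n (suc (suc m))) ⟩
    n ^ (1 + suc (suc m))        ∎
    where open ≤-Reasoning
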